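{- For every $n\ge 1$ and every $f:\{0,1\}^n\to\{0,1\}$, $\mathrm{FC}(f)\le \mathrm{EC}(f)$.
   Context: Let $f:\{0,1\}^n\to\{0,1\}$ and $[n]=\{1,\dots,n\}$. Fractional certificate complexity: for $x\in\{0,1\}^n$, $\mathrm{FC}(f,x)$ is the optimal value of the linear program: minimize $\sum_{i\in[n]}v_x(i)$ over $v_x\in\mathbb R^n$ with $v_x(i)\ge 0$ for all $i$, subject to $\sum_{i:x_i\ne y_i}v_x(i)\ge 1$ for all $y$ with $f(y)\ne f(x)$. $\mathrm{FC}(f)=\max_{x}\mathrm{FC}(f,x)$. The expectational certificate complexity $\mathrm{EC}(f)$ is the optimal value of the following program over families $\{w_x\}_{x\in\{0,1\}^n}$, $w_x\in\mathbb R^n$: minimize $\max_{x}\sum_{i=1}^n w_x(i)$ subject to $\sum_{i:x_i\ne y_i} w_x(i)w_y(i)\ge 1$ for all $x,y$ with $f(x)\ne f(y)$, and $0\le w_x(i)\le 1$ for all $x\in\{0,1\}^n$, $i\in[n]$. -}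

module Defs where

open import Data.Bool.Base using (Bool; true; false; if_then_else_)
import Data.Bool.Properties as Bool
open import Data.Fin.Base using (Fin)
open import Data.Nat.Base as ℕ using (ℕ; zero; suc)
import Data.Nat.Properties as ℕ
open import Data.Product.Base using (∃-syntax; _×_; _,_; proj₁; proj₂)
open import Data.Rational.Base as ℚ using (ℚ; 0ℚ; 1ℚ; ½; ∣_∣)
import Data.Rational.Properties as ℚ
open import Data.Rational.Solver using (module +-*-Solver)
open import Data.Sum.Base using (inj₁; inj₂)
open import Data.Vec.Base using (Vec; []; _∷_; lookup)
open import Data.Vec.Functional using (Vector; foldr)
open import Relation.Binary.PropositionalEquality
  using (_≡_; _≢_; refl; sym; trans; cong; cong₂; subst)
open import Relation.Nullary.Decidable using (does)

opaque
  half+half : ∀ ε → ½ ℚ.* ε ℚ.+ ½ ℚ.* ε ≡ ε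
  half+half ε = trans (sym (ℚ.*-distribʳ-+ ε ½ ½)) (ℚ.*-identityˡ ε)

  half-pos : ∀ {ε} → 0ℚ ℚ.< ε → 0ℚ ℚ.< ½ ℚ.* ε
  half-pos 0<ε = ℚ.*-monoʳ-<-pos ½ 0<ε

  p≤∣p∣ : ∀ p → p ℚ.≤ ∣ p ∣
  p≤∣p∣ p with ℚ.≤-total 0ℚ p
  ... | inj₁ 0≤p = ℚ.≤-reflexive (sym (ℚ.0≤p⇒∣p∣≡p 0≤p))
  ... | inj₂ p≤0 = ℚ.≤-trans p≤0 (ℚ.0≤∣p∣ p)

  p≤q+∣p-q∣ : ∀ p q → p ℚ.≤ q ℚ.+ ∣ p ℚ.- q ∣
  p≤q+∣p-q∣ p q = begin
    p                   ≡⟨ lem p q ⟩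
    q ℚ.+ (p ℚ.- q)     ≤⟨ ℚ.+-monoʳ-≤ q (p≤∣p∣ (p ℚ.- q)) ⟩
    q ℚ.+ ∣ p ℚ.- q ∣   ∎
    where
    open ℚ.≤-Reasoning
    open +-*-Solver
    lem : ∀ p q → p ≡ q ℚ.+ (p ℚ.- q)
    lem = solve 2 (λ p q → p := q :+ (p :- q)) refl

  p≤q+ε⇒p-q≤ε : ∀ p q {ε} → p ℚ.≤ q ℚ.+ ε → p ℚ.- q ℚ.≤ ε
  p≤q+ε⇒p-q≤ε p q {ε} h = begin
    p ℚ.- q             ≤⟨ ℚ.+-monoˡ-≤ (ℚ.- q) h ⟩
    (q ℚ.+ ε) ℚ.- q     ≡⟨ lem q ε ⟩
    ε                   ∎
    where
    open ℚ.≤-Reasoning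
    open +-*-Solver
    lem : ∀ q ε → (q ℚ.+ ε) ℚ.- q ≡ ε
    lem = solve 2 (λ q ε → (q :+ ε) :- q := ε) refl

  ∣-∣≤ : ∀ p q {ε} → p ℚ.≤ q ℚ.+ ε → q ℚ.≤ p ℚ.+ ε → ∣ p ℚ.- q ∣ ℚ.≤ ε
  ∣-∣≤ p q {ε} h k with ℚ.∣p∣≡p∨∣p∣≡-p (p ℚ.- q)
  ... | inj₁ e = subst (ℚ._≤ ε) (sym e) (p≤q+ε⇒p-q≤ε p q h)
  ... | inj₂ e = subst (ℚ._≤ ε) (sym (trans e (lem p q))) (p≤q+ε⇒p-q≤ε q p k)
    where
    open +-*-Solver
    lem : ∀ p q → ℚ.- (p ℚ.- q) ≡ q ℚ.- p
    lem = solve 2 (λ p q → :- (p :- q) := q :- p) refl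

  ⊔-close : ∀ p p′ q q′ {ε} → p ℚ.≤ p′ ℚ.+ ε → q ℚ.≤ q′ ℚ.+ ε →
            p ℚ.⊔ q ℚ.≤ (p′ ℚ.⊔ q′) ℚ.+ ε
  ⊔-close p p′ q q′ {ε} h k = ℚ.⊔-lub
    (ℚ.≤-trans h (ℚ.+-monoˡ-≤ ε (ℚ.p≤p⊔q p′ q′)))
    (ℚ.≤-trans k (ℚ.+-monoˡ-≤ ε (ℚ.p≤q⊔p p′ q′)))

  divide : ∀ {c ε} → 0ℚ ℚ.< c → 0ℚ ℚ.< ε → ∃[ δ ] (0ℚ ℚ.< δ) × (c ℚ.* δ ≡ ε)
  divide {c} {ε} 0<c 0<ε = c⁻¹ ℚ.* ε , 0<δ , cδ≡ε
    where
    instance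
      c-pos : ℚ.Positive c
      c-pos = ℚ.positive 0<c
      c-nonZero : ℚ.NonZero c
      c-nonZero = ℚ.pos⇒nonZero c
    c⁻¹ : ℚ
    c⁻¹ = ℚ.1/ c
    0<δ : 0ℚ ℚ.< c⁻¹ ℚ.* ε
    0<δ = subst (ℚ._< c⁻¹ ℚ.* ε) (ℚ.*-zeroʳ c⁻¹)
      (ℚ.*-monoʳ-<-pos c⁻¹ {{ℚ.1/pos⇒pos c}} 0<ε)
    cδ≡ε : c ℚ.* (c⁻¹ ℚ.* ε) ≡ ε
    cδ≡ε = trans (sym (ℚ.*-assoc c c⁻¹ ε))
      (trans (cong (ℚ._* ε) (ℚ.*-inverseʳ c)) (ℚ.*-identityˡ ε))

  ∣*∣≤ : ∀ a d {K δ} → 0ℚ ℚ.≤ K → ∣ a ∣ ℚ.≤ K → ∣ d ∣ ℚ.≤ δ → ∣ a ℚ.* d ∣ ℚ.≤ K ℚ.* δ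
  ∣*∣≤ a d {K} {δ} 0≤K a≤ d≤ = begin
    ∣ a ℚ.* d ∣       ≡⟨ ℚ.∣p*q∣≡∣p∣*∣q∣ a d ⟩
    ∣ a ∣ ℚ.* ∣ d ∣   ≤⟨ ℚ.*-monoʳ-≤-nonNeg ∣ d ∣ {{ℚ.∣-∣-nonNeg d}} a≤ ⟩
    K ℚ.* ∣ d ∣       ≤⟨ ℚ.*-monoˡ-≤-nonNeg K {{ℚ.nonNegative 0≤K}} d≤ ⟩
    K ℚ.* δ           ∎
    where open ℚ.≤-Reasoning

  *-close : ∀ a b c d {A B δ} → 0ℚ ℚ.≤ A → 0ℚ ℚ.≤ B → ∣ a ∣ ℚ.≤ A → ∣ d ∣ ℚ.≤ B →
            ∣ a ℚ.- c ∣ ℚ.≤ δ → ∣ b ℚ.- d ∣ ℚ.≤ δ →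
            ∣ a ℚ.* b ℚ.- c ℚ.* d ∣ ℚ.≤ (A ℚ.+ B) ℚ.* δ
  *-close a b c d {A} {B} {δ} 0≤A 0≤B a≤A d≤B a-c≤δ b-d≤δ = begin
    ∣ a ℚ.* b ℚ.- c ℚ.* d ∣
      ≡⟨ cong ∣_∣ (lem a b c d) ⟩
    ∣ a ℚ.* (b ℚ.- d) ℚ.+ d ℚ.* (a ℚ.- c) ∣
      ≤⟨ ℚ.∣p+q∣≤∣p∣+∣q∣ (a ℚ.* (b ℚ.- d)) (d ℚ.* (a ℚ.- c)) ⟩
    ∣ a ℚ.* (b ℚ.- d) ∣ ℚ.+ ∣ d ℚ.* (a ℚ.- c) ∣
      ≤⟨ ℚ.+-mono-≤ (∣*∣≤ a (b ℚ.- d) 0≤A a≤A b-d≤δ) (∣*∣≤ d (a ℚ.- c) 0≤B d≤B a-c≤δ) ⟩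
    A ℚ.* δ ℚ.+ B ℚ.* δ
      ≡⟨ sym (ℚ.*-distribʳ-+ δ A B) ⟩
    (A ℚ.+ B) ℚ.* δ ∎
    where
    open ℚ.≤-Reasoning
    open +-*-Solver
    lem : ∀ a b c d → a ℚ.* b ℚ.- c ℚ.* d ≡ a ℚ.* (b ℚ.- d) ℚ.+ d ℚ.* (a ℚ.- c)
    lem = solve 4 (λ a b c d →
      a :* b :- c :* d := a :* (b :- d) :+ d :* (a :- c)) refl

-- Real numbers, as Cauchy sequences of rationals.  They form a setoid: the
-- equality of x and y is x ≤ y × y ≤ x.

IsCauchy : (ℕ → ℚ) → Set
IsCauchy x = ∀ ε → 0ℚ ℚ.< ε →
  ∃[ N ] ∀ m n → N ℕ.≤ m → N ℕ.≤ n → ∣ x m ℚ.- x n ∣ ℚ.≤ ε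

record ℝ : Set where
  constructor mkℝ
  field
    seq    : ℕ → ℚ
    cauchy : IsCauchy seq

open ℝ public

infix 4 _≤_ _<_

-- Opaque because unfolding the arithmetic of ℚ makes type checking intractable.
opaque
  _≤_ : ℝ → ℝ → Set
  x ≤ y = ∀ ε → 0ℚ ℚ.< ε → ∃[ N ] ∀ n → N ℕ.≤ n → seq x n ℚ.≤ seq y n ℚ.+ ε

  _<_ : ℝ → ℝ → Set
  x < y = ∃[ ε ] (0ℚ ℚ.< ε) × ∃[ N ] ∀ n → N ℕ.≤ n → seq x n ℚ.+ ε ℚ.≤ seq y n

  const-cauchy : ∀ q → IsCauchy (λ _ → q)
  const-cauchy q ε 0<ε =
    0 , λ _ _ _ _ → ℚ.≤-trans (ℚ.≤-reflexive (cong ∣_∣ (ℚ.+-inverseʳ q))) (ℚ.<⇒≤ 0<ε)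

  fromℚ : ℚ → ℝ
  fromℚ q = mkℝ (λ _ → q) (const-cauchy q)

0ℝ 1ℝ : ℝ
0ℝ = fromℚ 0ℚ
1ℝ = fromℚ 1ℚ

opaque
  eventually-bounded : ∀ x → ∃[ B ] (0ℚ ℚ.< B) ×
                       ∃[ N ] ∀ n → N ℕ.≤ n → ∣ seq x n ∣ ℚ.≤ B
  eventually-bounded x with cauchy x 1ℚ (ℚ.positive⁻¹ 1ℚ)
  ... | N , h = ∣ a ∣ ℚ.+ 1ℚ
              , ℚ.+-mono-≤-< (ℚ.0≤∣p∣ a) (ℚ.positive⁻¹ 1ℚ)
              , N , λ n N≤n → begin
    ∣ seq x n ∣                         ≡⟨ cong ∣_∣ (lem (seq x n) a) ⟩
    ∣ a ℚ.+ (seq x n ℚ.- a) ∣           ≤⟨ ℚ.∣p+q∣≤∣p∣+∣q∣ a (seq x n ℚ.- a) ⟩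
    ∣ a ∣ ℚ.+ ∣ seq x n ℚ.- a ∣         ≤⟨ ℚ.+-monoʳ-≤ ∣ a ∣ (h n N N≤n ℕ.≤-refl) ⟩
    ∣ a ∣ ℚ.+ 1ℚ                        ∎
    where
    a : ℚ
    a = seq x N
    open ℚ.≤-Reasoning
    open +-*-Solver
    lem : ∀ p q → p ≡ q ℚ.+ (p ℚ.- q)
    lem = solve 2 (λ p q → p := q :+ (p :- q)) refl

  +-cauchy : ∀ x y → IsCauchy (λ n → seq x n ℚ.+ seq y n)
  +-cauchy x y ε 0<ε =
    let N₁ , h₁ = cauchy x (½ ℚ.* ε) (half-pos 0<ε)
        N₂ , h₂ = cauchy y (½ ℚ.* ε) (half-pos 0<ε)
    in N₁ ℕ.⊔ N₂ , λ m n N≤m N≤n → begin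
      ∣ (seq x m ℚ.+ seq y m) ℚ.- (seq x n ℚ.+ seq y n) ∣
        ≡⟨ cong ∣_∣ (lem (seq x m) (seq y m) (seq x n) (seq y n)) ⟩
      ∣ (seq x m ℚ.- seq x n) ℚ.+ (seq y m ℚ.- seq y n) ∣
        ≤⟨ ℚ.∣p+q∣≤∣p∣+∣q∣ (seq x m ℚ.- seq x n) (seq y m ℚ.- seq y n) ⟩
      ∣ seq x m ℚ.- seq x n ∣ ℚ.+ ∣ seq y m ℚ.- seq y n ∣
        ≤⟨ ℚ.+-mono-≤ (h₁ m n (ℕ.m⊔n≤o⇒m≤o N₁ N₂ N≤m) (ℕ.m⊔n≤o⇒m≤o N₁ N₂ N≤n))
                      (h₂ m n (ℕ.m⊔n≤o⇒n≤o N₁ N₂ N≤m) (ℕ.m⊔n≤o⇒n≤o N₁ N₂ N≤n)) ⟩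
      ½ ℚ.* ε ℚ.+ ½ ℚ.* ε
        ≡⟨ half+half ε ⟩
      ε ∎
    where
    open ℚ.≤-Reasoning
    open +-*-Solver
    lem : ∀ a b c d → (a ℚ.+ b) ℚ.- (c ℚ.+ d) ≡ (a ℚ.- c) ℚ.+ (b ℚ.- d)
    lem = solve 4 (λ a b c d → (a :+ b) :- (c :+ d) := (a :- c) :+ (b :- d)) refl

  ⊔-cauchy : ∀ x y → IsCauchy (λ n → seq x n ℚ.⊔ seq y n)
  ⊔-cauchy x y ε 0<ε =
    let N₁ , h₁ = cauchy x ε 0<ε
        N₂ , h₂ = cauchy y ε 0<ε
        close : ∀ m n → N₁ ℕ.⊔ N₂ ℕ.≤ m → N₁ ℕ.⊔ N₂ ℕ.≤ n →
                seq x m ℚ.⊔ seq y m ℚ.≤ (seq x n ℚ.⊔ seq y n) ℚ.+ ε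
        close m n N≤m N≤n = ⊔-close (seq x m) (seq x n) (seq y m) (seq y n)
          (ℚ.≤-trans (p≤q+∣p-q∣ (seq x m) (seq x n)) (ℚ.+-monoʳ-≤ (seq x n)
            (h₁ m n (ℕ.m⊔n≤o⇒m≤o N₁ N₂ N≤m) (ℕ.m⊔n≤o⇒m≤o N₁ N₂ N≤n))))
          (ℚ.≤-trans (p≤q+∣p-q∣ (seq y m) (seq y n)) (ℚ.+-monoʳ-≤ (seq y n)
            (h₂ m n (ℕ.m⊔n≤o⇒n≤o N₁ N₂ N≤m) (ℕ.m⊔n≤o⇒n≤o N₁ N₂ N≤n))))
    in N₁ ℕ.⊔ N₂ , λ m n N≤m N≤n →
      ∣-∣≤ (seq x m ℚ.⊔ seq y m) (seq x n ℚ.⊔ seq y n)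
           (close m n N≤m N≤n) (close n m N≤n N≤m)

  Bounded : ℝ → ℚ → ℕ → Set
  Bounded x B N = ∀ n → N ℕ.≤ n → ∣ seq x n ∣ ℚ.≤ B

  Within : ℝ → ℚ → ℕ → Set
  Within x δ N = ∀ m n → N ℕ.≤ m → N ℕ.≤ n → ∣ seq x m ℚ.- seq x n ∣ ℚ.≤ δ

  *-within : ∀ x y {A B δ ε N₁ N₂ N₃ N₄} → 0ℚ ℚ.< A → 0ℚ ℚ.< B →
    Bounded x A N₁ → Bounded y B N₂ → Within x δ N₃ → Within y δ N₄ →
    (A ℚ.+ B) ℚ.* δ ≡ ε →
    ∃[ N ] ∀ m n → N ℕ.≤ m → N ℕ.≤ n →
      ∣ seq x m ℚ.* seq y m ℚ.- seq x n ℚ.* seq y n ∣ ℚ.≤ ε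
  *-within x y {A} {B} {δ} {ε} {N₁} {N₂} {N₃} {N₄} 0<A 0<B bx by wx wy refl =
    M , λ m n M≤m M≤n →
      *-close (seq x m) (seq y m) (seq x n) (seq y n) {A} {B} {δ} (ℚ.<⇒≤ 0<A) (ℚ.<⇒≤ 0<B)
        (bx m (ℕ.m⊔n≤o⇒m≤o N₁ N₂ (left M≤m))) (by n (ℕ.m⊔n≤o⇒n≤o N₁ N₂ (left M≤n)))
        (wx m n (ℕ.m⊔n≤o⇒m≤o N₃ N₄ (right M≤m)) (ℕ.m⊔n≤o⇒m≤o N₃ N₄ (right M≤n)))
        (wy m n (ℕ.m⊔n≤o⇒n≤o N₃ N₄ (right M≤m)) (ℕ.m⊔n≤o⇒n≤o N₃ N₄ (right M≤n)))
    where
    M : ℕ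
    M = (N₁ ℕ.⊔ N₂) ℕ.⊔ (N₃ ℕ.⊔ N₄)
    left : ∀ {k} → M ℕ.≤ k → N₁ ℕ.⊔ N₂ ℕ.≤ k
    left = ℕ.m⊔n≤o⇒m≤o (N₁ ℕ.⊔ N₂) (N₃ ℕ.⊔ N₄)
    right : ∀ {k} → M ℕ.≤ k → N₃ ℕ.⊔ N₄ ℕ.≤ k
    right = ℕ.m⊔n≤o⇒n≤o (N₁ ℕ.⊔ N₂) (N₃ ℕ.⊔ N₄)

  *-cauchy : ∀ x y → IsCauchy (λ n → seq x n ℚ.* seq y n)
  *-cauchy x y ε 0<ε =
    let A , 0<A , _ , bx = eventually-bounded x
        B , 0<B , _ , by = eventually-bounded y
        δ , 0<δ , Cδ≡ε = divide {A ℚ.+ B} {ε} (ℚ.+-mono-< 0<A 0<B) 0<ε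
        _ , wx = cauchy x δ 0<δ
        _ , wy = cauchy y δ 0<δ
    in *-within x y {A} {B} {δ} {ε} 0<A 0<B bx by wx wy Cδ≡ε

infixl 6 _+_ _⊔_
infixl 7 _*_

opaque
  unfolding _≤_

  _+_ : ℝ → ℝ → ℝ
  x + y = mkℝ (λ n → seq x n ℚ.+ seq y n) (+-cauchy x y)

  _⊔_ : ℝ → ℝ → ℝ
  x ⊔ y = mkℝ (λ n → seq x n ℚ.⊔ seq y n) (⊔-cauchy x y)

  _*_ : ℝ → ℝ → ℝ
  x * y = mkℝ (λ n → seq x n ℚ.* seq y n) (*-cauchy x y)

  <-upward : ∀ x {p q} → p ℚ.≤ q → x < fromℚ p → x < fromℚ q
  <-upward x p≤q (ε , 0<ε , N , h) = ε , 0<ε , N , λ n N≤n → ℚ.≤-trans (h n N≤n) p≤q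

  <-rounded : ∀ x {q} → x < fromℚ q → ∃[ p ] (p ℚ.< q) × (x < fromℚ p)
  <-rounded x {q} (ε , 0<ε , N , h) =
    q ℚ.- ½ε , q-½ε<q , ½ε , half-pos 0<ε , N , λ n N≤n → begin
      seq x n ℚ.+ ½ε                 ≡⟨ lem (seq x n) ½ε ⟩
      (seq x n ℚ.+ (½ε ℚ.+ ½ε)) ℚ.- ½ε
        ≡⟨ cong (λ z → (seq x n ℚ.+ z) ℚ.- ½ε) (half+half ε) ⟩
      (seq x n ℚ.+ ε) ℚ.- ½ε         ≤⟨ ℚ.+-monoˡ-≤ (ℚ.- ½ε) (h n N≤n) ⟩
      q ℚ.- ½ε                       ∎
    where
    ½ε : ℚ
    ½ε = ½ ℚ.* ε
    q-½ε<q : q ℚ.- ½ε ℚ.< q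
    q-½ε<q = subst (q ℚ.- ½ε ℚ.<_) (ℚ.+-identityʳ q)
      (ℚ.+-monoʳ-< q (ℚ.neg-antimono-< (half-pos 0<ε)))
    open ℚ.≤-Reasoning
    open +-*-Solver
    lem : ∀ a b → a ℚ.+ b ≡ (a ℚ.+ (b ℚ.+ b)) ℚ.- b
    lem = solve 2 (λ a b → a :+ b := (a :+ (b :+ b)) :- b) refl

∑ : ∀ {n} → Vector ℝ n → ℝ
∑ = foldr _+_ 0ℝ

-- Infima of sets of reals.  Without a classical completeness axiom, an infimum
-- is given by its upper cut: the set of all rationals strictly above it.  The order
-- is reverse inclusion of cuts; fromℝ embeds the order of ℝ (fromℝ-mono and
-- fromℝ-cancel below).

record UpperReal : Set₁ where
  field
    Above   : ℚ → Set
    upward  : ∀ {p q} → p ℚ.≤ q → Above p → Above q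
    rounded : ∀ {q} → Above q → ∃[ p ] (p ℚ.< q) × Above p

open UpperReal public

infix 4 _≤ᵘ_

_≤ᵘ_ : UpperReal → UpperReal → Set
U ≤ᵘ V = ∀ q → Above V q → Above U q

infixl 6 _⊔ᵘ_

-- A rational is above a maximum when it is above both.
_⊔ᵘ_ : UpperReal → UpperReal → UpperReal
Above   (U ⊔ᵘ V) q = Above U q × Above V q
upward  (U ⊔ᵘ V) p≤q (u , v) = upward U p≤q u , upward V p≤q v
rounded (U ⊔ᵘ V) (u , v) with rounded U u | rounded V v
... | p , p<q , u′ | p′ , p′<q , v′ =
  p ℚ.⊔ p′ , ⊔-< p p′ p<q p′<q , upward U (ℚ.p≤p⊔q p p′) u′ , upward V (ℚ.p≤q⊔p p p′) v′
  where
  ⊔-< : ∀ p p′ {q} → p ℚ.< q → p′ ℚ.< q → p ℚ.⊔ p′ ℚ.< q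
  ⊔-< p p′ {q} h h′ with ℚ.⊔-sel p p′
  ... | inj₁ e = subst (ℚ._< q) (sym e) h
  ... | inj₂ e = subst (ℚ._< q) (sym e) h′

fromℝ : ℝ → UpperReal
Above   (fromℝ x) q = x < fromℚ q
upward  (fromℝ x) = <-upward x
rounded (fromℝ x) = <-rounded x

-- The infimum of obj a over all feasible a.
minimise : {A : Set} (obj : A → ℝ) (Feasible : A → Set) → UpperReal
Above   (minimise obj Feasible) q = ∃[ a ] Feasible a × (obj a < fromℚ q)
upward  (minimise obj Feasible) p≤q (a , F , h) = a , F , upward (fromℝ (obj a)) p≤q h
rounded (minimise obj Feasible) (a , F , h) =
  let p , p<q , h′ = rounded (fromℝ (obj a)) h in p , p<q , a , F , h′

opaque
  unfolding _≤_

  fromℝ-mono : ∀ {x y} → x ≤ y → fromℝ x ≤ᵘ fromℝ y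
  fromℝ-mono {x} {y} x≤y q (ε , 0<ε , N , h) with x≤y (½ ℚ.* ε) (half-pos 0<ε)
  ... | N′ , h′ = ½ε , half-pos 0<ε , N ℕ.⊔ N′ , λ n N≤n → begin
      seq x n ℚ.+ ½ε                ≤⟨ ℚ.+-monoˡ-≤ ½ε (h′ n (ℕ.m⊔n≤o⇒n≤o N N′ N≤n)) ⟩
      (seq y n ℚ.+ ½ε) ℚ.+ ½ε       ≡⟨ ℚ.+-assoc (seq y n) ½ε ½ε ⟩
      seq y n ℚ.+ (½ε ℚ.+ ½ε)       ≡⟨ cong (seq y n ℚ.+_) (half+half ε) ⟩
      seq y n ℚ.+ ε                 ≤⟨ h n (ℕ.m⊔n≤o⇒m≤o N N′ N≤n) ⟩
      q                             ∎
    where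
    ½ε : ℚ
    ½ε = ½ ℚ.* ε
    open ℚ.≤-Reasoning

  fromℝ-cancel : ∀ {x y} → fromℝ x ≤ᵘ fromℝ y → x ≤ y
  fromℝ-cancel {x} {y} x≤y ε 0<ε = M , λ n M≤n → begin
      seq x n                        ≡⟨ sym (ℚ.+-identityʳ (seq x n)) ⟩
      seq x n ℚ.+ 0ℚ                 ≤⟨ ℚ.+-monoʳ-≤ (seq x n) (ℚ.<⇒≤ 0<η) ⟩
      seq x n ℚ.+ η                  ≤⟨ hx n (ℕ.m⊔n≤o⇒n≤o N Nₓ M≤n) ⟩
      a ℚ.+ (δ ℚ.+ δ)                ≤⟨ ℚ.+-monoˡ-≤ (δ ℚ.+ δ) (near N n ℕ.≤-refl (ℕ.m⊔n≤o⇒m≤o N Nₓ M≤n)) ⟩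
      (seq y n ℚ.+ δ) ℚ.+ (δ ℚ.+ δ)  ≤⟨ ℚ.+-monoʳ-≤ (seq y n ℚ.+ δ) (lower (δ ℚ.+ δ) δ (ℚ.<⇒≤ 0<δ)) ⟩
      (seq y n ℚ.+ δ) ℚ.+ ((δ ℚ.+ δ) ℚ.+ δ)  ≡⟨ lem (seq y n) δ ⟩
      seq y n ℚ.+ ((δ ℚ.+ δ) ℚ.+ (δ ℚ.+ δ))  ≡⟨ cong (seq y n ℚ.+_) 4δ≡ε ⟩
      seq y n ℚ.+ ε                  ∎
    where
    δ : ℚ
    δ = ½ ℚ.* (½ ℚ.* ε)
    0<δ : 0ℚ ℚ.< δ
    0<δ = half-pos (half-pos 0<ε)
    4δ≡ε : (δ ℚ.+ δ) ℚ.+ (δ ℚ.+ δ) ≡ ε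
    4δ≡ε = trans (cong₂ ℚ._+_ (half+half (½ ℚ.* ε)) (half+half (½ ℚ.* ε))) (half+half ε)
    N : ℕ
    N = proj₁ (cauchy y δ 0<δ)
    a : ℚ
    a = seq y N
    near : ∀ m n → N ℕ.≤ m → N ℕ.≤ n → seq y m ℚ.≤ seq y n ℚ.+ δ
    near m n N≤m N≤n = ℚ.≤-trans (p≤q+∣p-q∣ (seq y m) (seq y n))
      (ℚ.+-monoʳ-≤ (seq y n) (proj₂ (cauchy y δ 0<δ) m n N≤m N≤n))
    y<q : y < fromℚ (a ℚ.+ (δ ℚ.+ δ))
    y<q = δ , 0<δ , N , λ n N≤n → ℚ.≤-trans
      (ℚ.+-monoˡ-≤ δ (near n N N≤n ℕ.≤-refl)) (ℚ.≤-reflexive (ℚ.+-assoc a δ δ))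
    x<q : x < fromℚ (a ℚ.+ (δ ℚ.+ δ))
    x<q = x≤y (a ℚ.+ (δ ℚ.+ δ)) y<q
    η : ℚ
    η = proj₁ x<q
    0<η : 0ℚ ℚ.< η
    0<η = proj₁ (proj₂ x<q)
    Nₓ : ℕ
    Nₓ = proj₁ (proj₂ (proj₂ x<q))
    hx : ∀ n → Nₓ ℕ.≤ n → seq x n ℚ.+ η ℚ.≤ a ℚ.+ (δ ℚ.+ δ)
    hx = proj₂ (proj₂ (proj₂ x<q))
    M : ℕ
    M = N ℕ.⊔ Nₓ
    open ℚ.≤-Reasoning
    lower : ∀ p q → 0ℚ ℚ.≤ q → p ℚ.≤ p ℚ.+ q
    lower p q 0≤q = subst (ℚ._≤ p ℚ.+ q) (ℚ.+-identityʳ p) (ℚ.+-monoʳ-≤ p 0≤q)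
    open +-*-Solver
    lem : ∀ a d → (a ℚ.+ d) ℚ.+ ((d ℚ.+ d) ℚ.+ d) ≡ a ℚ.+ ((d ℚ.+ d) ℚ.+ (d ℚ.+ d))
    lem = solve 2 (λ a d →
      (a :+ d) :+ ((d :+ d) :+ d) := a :+ ((d :+ d) :+ (d :+ d))) refl

-- minimise obj Feasible is the greatest lower bound of the feasible values;
-- a minimum, when attained, is therefore equal to it.

minimise-lower : {A : Set} (obj : A → ℝ) (Feasible : A → Set) →
  ∀ a → Feasible a → minimise obj Feasible ≤ᵘ fromℝ (obj a)
minimise-lower obj Feasible a F q h = a , F , h

minimise-greatest : {A : Set} (obj : A → ℝ) (Feasible : A → Set) →
  ∀ x → (∀ a → Feasible a → x ≤ obj a) → fromℝ x ≤ᵘ minimise obj Feasible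
minimise-greatest obj Feasible x lb q (a , F , h) = fromℝ-mono {x} {obj a} (lb a F) q h

-- Maximum over the Boolean cube, with _∨_ the binary maximum.
maxOver : ∀ {a} {A : Set a} (_∨_ : A → A → A) {n} → (Vec Bool n → A) → A
maxOver _∨_ {zero}  g = g []
maxOver _∨_ {suc n} g =
  maxOver _∨_ (λ x → g (false ∷ x)) ∨ maxOver _∨_ (λ x → g (true ∷ x))

-- ∑≠ x y v is the sum of v i over all i with x_i ≠ y_i.
∑≠ : ∀ {n} → Vec Bool n → Vec Bool n → Vector ℝ n → ℝ
∑≠ x y v = ∑ λ i → if does (lookup x i Bool.≟ lookup y i) then 0ℝ else v i

module _ {n : ℕ} (f : Vec Bool n → Bool) where

  record FCFeasible (x : Vec Bool n) (v : Vector ℝ n) : Set where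
    field
      nonNegative : ∀ i → 0ℝ ≤ v i
      covers      : ∀ y → f y ≢ f x → 1ℝ ≤ ∑≠ x y v

  FCAt : Vec Bool n → UpperReal
  FCAt x = minimise ∑ (FCFeasible x)

  FC : UpperReal
  FC = maxOver _⊔ᵘ_ FCAt

  record ECFeasible (w : Vec Bool n → Vector ℝ n) : Set where
    field
      nonNegative : ∀ x i → 0ℝ ≤ w x i
      atMostOne   : ∀ x i → w x i ≤ 1ℝ
      covers      : ∀ x y → f x ≢ f y → 1ℝ ≤ ∑≠ x y (λ i → w x i * w y i)

  EC : UpperReal
  EC = minimise (λ w → maxOver _⊔_ (λ x → ∑ (w x))) ECFeasible

{-# OPTIONS --safe #-}
-- Each row w x of an EC-feasible family is FC-feasible at x: since w y i ≤ 1,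
-- dropping the factors w y i only increases the covering sums.

module Submission where

open import Defs
open import Data.Bool.Base using (Bool; true; false; if_then_else_)
import Data.Bool.Properties as Bool
open import Data.Fin.Base using (zero; suc)
open import Data.Nat.Base as ℕ using (ℕ; zero; suc; _≥_)
import Data.Nat.Properties as ℕ
open import Data.Product.Base using (_,_)
open import Data.Rational.Base as ℚ using (ℚ; 0ℚ; 1ℚ; ½; ∣_∣)
import Data.Rational.Properties as ℚ
open import Data.Rational.Solver using (module +-*-Solver)
open import Data.Sum.Base using (inj₁; inj₂)
open import Data.Vec.Base using (Vec; []; _∷_; lookup)
open import Data.Vec.Functional using (Vector; tail)
open import Relation.Binary.PropositionalEquality
  using (_≡_; refl; sym; cong; ≢-sym)
open import Relation.Nullary.Decidable using (does)

-- For an `EC`-feasible `w`, nonnegativity and `w y i ≤ 1` give `w x i * w y i ≤ w x i`, so the row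
-- `w x` alone still covers every `y` with the other value. Its cost is at most the maximum over all
-- rows. In terms of cuts, a rational above `EC f` comes with such a `w`, and the rows of `w`
-- witness that the same rational is above every `FCAt f x`; no optimum has to be attained. The
-- analytic core is `x*y≤x`, which termwise is a rational estimate with an error.

-- Terms of a nonnegative real may be slightly negative, and terms of a real at most 1 may slightly
-- exceed 1. Either sign of `p` thus leaves its own error, and each tolerance is scaled to make that
-- error `ε`.
p*q≤p+ε : ∀ p q {A B δ₁ δ₂ ε} → 0ℚ ℚ.≤ p ℚ.+ δ₁ → q ℚ.≤ 1ℚ ℚ.+ δ₂ →
  ∣ p ∣ ℚ.≤ A → ∣ q ∣ ℚ.≤ B → 0ℚ ℚ.≤ δ₂ → 0ℚ ℚ.≤ 1ℚ ℚ.+ B →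
  (1ℚ ℚ.+ B) ℚ.* δ₁ ≡ ε → A ℚ.* δ₂ ≡ ε → p ℚ.* q ℚ.≤ p ℚ.+ ε
p*q≤p+ε p q {A} {B} {δ₁} {δ₂} {ε} 0≤p+δ₁ q≤1+δ₂ ∣p∣≤A ∣q∣≤B 0≤δ₂ 0≤1+B δ₁-eq δ₂-eq
  with ℚ.≤-total 0ℚ p
... | inj₁ 0≤p = begin
  p ℚ.* q              ≤⟨ ℚ.*-monoˡ-≤-nonNeg p {{ℚ.nonNegative 0≤p}} q≤1+δ₂ ⟩
  p ℚ.* (1ℚ ℚ.+ δ₂)    ≡⟨ lem p δ₂ ⟩
  p ℚ.+ p ℚ.* δ₂       ≤⟨ ℚ.+-monoʳ-≤ p (ℚ.*-monoʳ-≤-nonNeg δ₂ {{ℚ.nonNegative 0≤δ₂}}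
                            (ℚ.≤-trans (p≤∣p∣ p) ∣p∣≤A)) ⟩
  p ℚ.+ A ℚ.* δ₂       ≡⟨ cong (p ℚ.+_) δ₂-eq ⟩
  p ℚ.+ ε              ∎
  where
  open ℚ.≤-Reasoning
  open +-*-Solver
  lem : ∀ p d → p ℚ.* (1ℚ ℚ.+ d) ≡ p ℚ.+ p ℚ.* d
  lem = solve 2 (λ p d → p :* (con 1ℚ :+ d) := p :+ p :* d) refl
... | inj₂ p≤0 = begin
  p ℚ.* q                              ≡⟨ lem p q ⟩
  -- For `p ≤ 0` an upper bound on `q` is of no help: `q` must not be too far below 1, which `∣q∣≤B`
  -- ensures.
  p ℚ.+ (ℚ.- p) ℚ.* (1ℚ ℚ.+ ℚ.- q)     ≤⟨ ℚ.+-monoʳ-≤ p (ℚ.*-monoˡ-≤-nonNeg (ℚ.- p)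
                                            {{ℚ.nonNegative (ℚ.neg-antimono-≤ p≤0)}}
                                            (ℚ.+-monoʳ-≤ 1ℚ -q≤B)) ⟩
  p ℚ.+ (ℚ.- p) ℚ.* (1ℚ ℚ.+ B)         ≤⟨ ℚ.+-monoʳ-≤ p (ℚ.*-monoʳ-≤-nonNeg (1ℚ ℚ.+ B)
                                            {{ℚ.nonNegative 0≤1+B}} -p≤δ₁) ⟩
  p ℚ.+ δ₁ ℚ.* (1ℚ ℚ.+ B)              ≡⟨ cong (p ℚ.+_) (ℚ.*-comm δ₁ (1ℚ ℚ.+ B)) ⟩
  p ℚ.+ (1ℚ ℚ.+ B) ℚ.* δ₁              ≡⟨ cong (p ℚ.+_) δ₁-eq ⟩
  p ℚ.+ ε                              ∎
  where
  open ℚ.≤-Reasoning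
  open +-*-Solver
  lem : ∀ p q → p ℚ.* q ≡ p ℚ.+ (ℚ.- p) ℚ.* (1ℚ ℚ.+ ℚ.- q)
  lem = solve 2 (λ p q → p :* q := p :+ (:- p) :* (con 1ℚ :+ :- q)) refl
  -q≤B : ℚ.- q ℚ.≤ B
  -q≤B = ℚ.≤-trans (p≤∣p∣ (ℚ.- q)) (ℚ.≤-trans (ℚ.≤-reflexive (ℚ.∣-p∣≡∣p∣ q)) ∣q∣≤B)
  -p≤δ₁ : ℚ.- p ℚ.≤ δ₁
  -p≤δ₁ = ℚ.≤-trans (ℚ.≤-reflexive (sym (ℚ.+-identityˡ (ℚ.- p)))) (p≤q+ε⇒p-q≤ε 0ℚ p 0≤p+δ₁)

opaque
  unfolding _*_

  ≤-refl : ∀ {x} → x ≤ x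
  ≤-refl {x} ε 0<ε = 0 , λ n _ →
    ℚ.≤-trans (ℚ.≤-reflexive (sym (ℚ.+-identityʳ (seq x n)))) (ℚ.+-monoʳ-≤ (seq x n) (ℚ.<⇒≤ 0<ε))

  -- Inclusions of upper cuts compose, so passing through `fromℝ` spares splitting `ε`.
  ≤-trans : ∀ {x y z} → x ≤ y → y ≤ z → x ≤ z
  ≤-trans {x} {y} {z} x≤y y≤z = fromℝ-cancel {x} {z}
    (λ q z<q → fromℝ-mono {x} {y} x≤y q (fromℝ-mono {y} {z} y≤z q z<q))

  +-mono-≤ : ∀ {x x′ y y′} → x ≤ x′ → y ≤ y′ → x + y ≤ x′ + y′
  +-mono-≤ {x} {x′} {y} {y′} x≤x′ y≤y′ ε 0<ε =
    let N , h = x≤x′ (½ ℚ.* ε) (half-pos 0<ε)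
        M , k = y≤y′ (½ ℚ.* ε) (half-pos 0<ε)
    in N ℕ.⊔ M , λ n ≤n → begin
      seq x n ℚ.+ seq y n
        ≤⟨ ℚ.+-mono-≤ (h n (ℕ.m⊔n≤o⇒m≤o N M ≤n)) (k n (ℕ.m⊔n≤o⇒n≤o N M ≤n)) ⟩
      (seq x′ n ℚ.+ ½ ℚ.* ε) ℚ.+ (seq y′ n ℚ.+ ½ ℚ.* ε)
        ≡⟨ lem (seq x′ n) (seq y′ n) (½ ℚ.* ε) ⟩
      (seq x′ n ℚ.+ seq y′ n) ℚ.+ (½ ℚ.* ε ℚ.+ ½ ℚ.* ε)
        ≡⟨ cong ((seq x′ n ℚ.+ seq y′ n) ℚ.+_) (half+half ε) ⟩
      (seq x′ n ℚ.+ seq y′ n) ℚ.+ ε ∎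
    where
    open ℚ.≤-Reasoning
    open +-*-Solver
    lem : ∀ a b e → (a ℚ.+ e) ℚ.+ (b ℚ.+ e) ≡ (a ℚ.+ b) ℚ.+ (e ℚ.+ e)
    lem = solve 3 (λ a b e → (a :+ e) :+ (b :+ e) := (a :+ b) :+ (e :+ e)) refl

  x≤x⊔y : ∀ x y → x ≤ x ⊔ y
  x≤x⊔y x y ε 0<ε =
    let N , h = ≤-refl {x} ε 0<ε
    in N , λ n N≤n → ℚ.≤-trans (h n N≤n) (ℚ.+-monoˡ-≤ ε (ℚ.p≤p⊔q (seq x n) (seq y n)))

  y≤x⊔y : ∀ x y → y ≤ x ⊔ y
  y≤x⊔y x y ε 0<ε =
    let N , h = ≤-refl {y} ε 0<ε
    in N , λ n N≤n → ℚ.≤-trans (h n N≤n) (ℚ.+-monoˡ-≤ ε (ℚ.p≤q⊔p (seq x n) (seq y n)))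

  x*y≤x : ∀ {x y} → 0ℝ ≤ x → y ≤ 1ℝ → x * y ≤ x
  x*y≤x {x} {y} 0≤x y≤1 ε 0<ε =
    let A , 0<A , N₁ , bx = eventually-bounded x
        B , 0<B , N₂ , by = eventually-bounded y
        0<1+B = ℚ.+-mono-< (ℚ.positive⁻¹ 1ℚ) 0<B
        -- The bounds `A` and `B` are fixed first: `δ₁` is multiplied by at most `1 + B`, and `δ₂`
        -- by at most `A`.
        δ₁ , 0<δ₁ , δ₁-eq = divide {1ℚ ℚ.+ B} {ε} 0<1+B 0<ε
        δ₂ , 0<δ₂ , δ₂-eq = divide {A} {ε} 0<A 0<ε
        N₃ , hx = 0≤x δ₁ 0<δ₁
        N₄ , hy = y≤1 δ₂ 0<δ₂
    in (N₁ ℕ.⊔ N₂) ℕ.⊔ (N₃ ℕ.⊔ N₄) , λ n ≤n →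
      let ≤ˡ = ℕ.m⊔n≤o⇒m≤o (N₁ ℕ.⊔ N₂) (N₃ ℕ.⊔ N₄) ≤n
          ≤ʳ = ℕ.m⊔n≤o⇒n≤o (N₁ ℕ.⊔ N₂) (N₃ ℕ.⊔ N₄) ≤n
      in p*q≤p+ε (seq x n) (seq y n)
           (hx n (ℕ.m⊔n≤o⇒m≤o N₃ N₄ ≤ʳ)) (hy n (ℕ.m⊔n≤o⇒n≤o N₃ N₄ ≤ʳ))
           (bx n (ℕ.m⊔n≤o⇒m≤o N₁ N₂ ≤ˡ)) (by n (ℕ.m⊔n≤o⇒n≤o N₁ N₂ ≤ˡ))
           (ℚ.<⇒≤ 0<δ₂) (ℚ.<⇒≤ 0<1+B) δ₁-eq δ₂-eq

∑-mono-≤ : ∀ {n} {v w : Vector ℝ n} → (∀ i → v i ≤ w i) → ∑ v ≤ ∑ w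
∑-mono-≤ {zero}          v≤w = ≤-refl {0ℝ}
∑-mono-≤ {suc n} {v} {w} v≤w =
  +-mono-≤ {v zero} {w zero} {∑ (tail v)} {∑ (tail w)}
    (v≤w zero) (∑-mono-≤ {v = tail v} {tail w} (λ i → v≤w (suc i)))

∑≠-mono-≤ : ∀ {n} (x y : Vec Bool n) {v w : Vector ℝ n} →
  (∀ i → v i ≤ w i) → ∑≠ x y v ≤ ∑≠ x y w
∑≠-mono-≤ x y v≤w =
  ∑-mono-≤ (λ i → if-mono-≤ (does (lookup x i Bool.≟ lookup y i)) (v≤w i))
  where
  if-mono-≤ : ∀ b {s t} → s ≤ t → (if b then 0ℝ else s) ≤ (if b then 0ℝ else t)
  if-mono-≤ true  _   = ≤-refl {0ℝ}
  if-mono-≤ false s≤t = s≤t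

≤-maxOver : ∀ {n} (g : Vec Bool n → ℝ) x → g x ≤ maxOver _⊔_ g
≤-maxOver g []          = ≤-refl {g []}
≤-maxOver g (false ∷ x) =
  ≤-trans {g (false ∷ x)} {l} {l ⊔ r} (≤-maxOver (λ x → g (false ∷ x)) x) (x≤x⊔y l r)
  where
  l = maxOver _⊔_ (λ x → g (false ∷ x))
  r = maxOver _⊔_ (λ x → g (true ∷ x))
≤-maxOver g (true ∷ x) =
  ≤-trans {g (true ∷ x)} {r} {l ⊔ r} (≤-maxOver (λ x → g (true ∷ x)) x) (y≤x⊔y l r)
  where
  l = maxOver _⊔_ (λ x → g (false ∷ x))
  r = maxOver _⊔_ (λ x → g (true ∷ x))

Above-maxOver : ∀ {n} (U : Vec Bool n → UpperReal) {q} →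
  (∀ x → Above (U x) q) → Above (maxOver _⊔ᵘ_ U) q
Above-maxOver {zero}  U above = above []
Above-maxOver {suc n} U above =
  Above-maxOver (λ x → U (false ∷ x)) (λ x → above (false ∷ x)) ,
  Above-maxOver (λ x → U (true ∷ x)) (λ x → above (true ∷ x))

ECFeasible⇒FCFeasible : ∀ {n} {f : Vec Bool n → Bool} {w} →
  ECFeasible f w → ∀ x → FCFeasible f x (w x)
ECFeasible⇒FCFeasible {w = w} F x = record
  { nonNegative = nonNegative x
  ; covers      = λ y fy≢fx →
      ≤-trans {1ℝ} {∑≠ x y (λ i → w x i * w y i)} {∑≠ x y (w x)}
        (covers x y (≢-sym fy≢fx))
        -- The two bounds come from different rows: the sign from row `x`, the upper bound 1 from
        -- row `y`.
        (∑≠-mono-≤ x y (λ i → x*y≤x {w x i} {w y i} (nonNegative x i) (atMostOne y i)))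
  }
  where open ECFeasible F

lemma7 : ∀ (n : ℕ) → n ≥ 1 → (f : Vec Bool n → Bool) → FC f ≤ᵘ EC f
lemma7 n n≥1 f q (w , F , max<q) = Above-maxOver (FCAt f) λ x →
  -- Row `x` is the witness at `x`; the strict bound `max<q` passes down to its sum, which lies
  -- below the maximum.
  w x , ECFeasible⇒FCFeasible F x ,
  fromℝ-mono {∑ (w x)} {maxOver _⊔_ (λ x → ∑ (w x))} (≤-maxOver (λ x → ∑ (w x)) x) q max<q
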